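{- Over $\mathrm{HA}^\omega$, the dependent iterated skewed product $\mathsf{MBR}$ is $T$-definable from the simple iterated skewed product $\mathsf{mbr}$; that is, $\mathsf{mbr}\geq_T\mathsf{MBR}$.
   Context: Types and systems. Finite types are generated from $\mathbb{B}$ (booleans) and $\mathbb{N}$ by $X\times Y$, $X\to Y$ and $X^*$ (finite sequences). For a sequence of types $(X_i)_{i\in\mathbb{N}}$, $\Pi_i X_i$ is the type of infinite sequences whose $i$-th entry is in $X_i$ and $\Pi_{i<n}X_i$ the type of finite sequences of length $n$. (This is used for readability; one may take all $X_i$ equal to one type $X$, reading $\Pi_iX_i$ as $\mathbb{N}\to X$ and finite sequence types as $X^*$.) $\mathrm{HA}^\omega$ is Heyting arithmetic in all finite types with fully extensional equality (Troelstra's E-$\mathrm{HA}^\omega$); system $T$ is its quantifier-free fragment (Gödel's primitive recursive functionals). Notation. $*$ is concatenation; $|s|$ is the length of $s$; $q_x(\alpha)=q(x*\alpha)$. $T$-definability. A functional is specified by a defining equation (for each choice of type parameters). $G$ is $T$-definable from $F$ over a theory $\mathcal{S}$ (written $F\ge_T G$) if for each choice of types for $G$ there are a choice of types for $F$ and a term $s$ of system $T$ such that $s(F)$ satisfies the defining equation of $G$, provably in $\mathcal{S}$ together with the defining equation of $F$. $\mathsf{mbr}$. For $\varepsilon=(\varepsilon_n)_{n\in\mathbb{N}}$ with $\varepsilon_n\colon(X_n\to R)\to\Pi_iX_{i+n}$ and $q\colon\Pi_iX_{i+n}\to R$, $\mathsf{mbr}_n(\varepsilon)(q)\colon\Pi_iX_{i+n}$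 is specified by $\mathsf{mbr}_n(\varepsilon)(q)=\varepsilon_n(\lambda x.\,q_x(\mathsf{mbr}_{n+1}(\varepsilon)(q_x)))$. $\mathsf{MBR}$. For a family $\varepsilon_s\colon(X_{|s|}\to R)\to\Pi_iX_{i+|s|}$ indexed by finite sequences $s\colon\Pi_{i<|s|}X_i$ and $q\colon\Pi_iX_{i+|s|}\to R$, $\mathsf{MBR}_s(\varepsilon)(q)\colon\Pi_iX_{i+|s|}$ is specified by $\mathsf{MBR}_s(\varepsilon)(q)=\varepsilon_s(\lambda x.\,q_x(\mathsf{MBR}_{s*x}(\varepsilon)(q_x)))$. -}

module Defs where

open import Data.List using (List; []; _∷_; map)
open import Data.List.Membership.Propositional using (_∈_)
open import Data.List.Relation.Binary.Subset.Propositional using (_⊆_)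
open import Data.List.Relation.Unary.Any using (here; there)
open import Data.Product using (Σ; _×_; _,_)
open import Function using (id; _∘_)
open import Relation.Binary.PropositionalEquality using (refl)

infixr 6 _⇒_
infixr 7 _⊗_

data Ty : Set where
  bool nat : Ty
  _⊗_ _⇒_  : Ty → Ty → Ty
  seq      : Ty → Ty

Ctx : Set
Ctx = List Ty

variable
  Γ Δ       : Ctx
  ρ σ τ υ ω : Ty

infixl 9 _·_

-- The terms of system T.  Finite sequences are generated from the empty one by
-- appending an entry at the end: snoc · s · x is s * x.
data Term (Γ : Ctx) : Ty → Set where
  var   : σ ∈ Γ → Term Γ σ
  lam   : Term (σ ∷ Γ) τ → Term Γ (σ ⇒ τ)
  _·_   : Term Γ (σ ⇒ τ) → Term Γ σ → Term Γ τ
  true  : Term Γ bool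
  false : Term Γ bool
  cond  : Term Γ (bool ⇒ σ ⇒ σ ⇒ σ)
  zero  : Term Γ nat
  suc   : Term Γ (nat ⇒ nat)
  rec   : Term Γ (σ ⇒ (nat ⇒ σ ⇒ σ) ⇒ nat ⇒ σ)
  pair  : Term Γ (σ ⇒ τ ⇒ σ ⊗ τ)
  fst   : Term Γ (σ ⊗ τ ⇒ σ)
  snd   : Term Γ (σ ⊗ τ ⇒ τ)
  nil   : Term Γ (seq σ)
  snoc  : Term Γ (seq σ ⇒ σ ⇒ seq σ)
  seqrec : Term Γ (σ ⇒ (seq τ ⇒ τ ⇒ σ ⇒ σ) ⇒ seq τ ⇒ σ)

ext : Γ ⊆ Δ → (σ ∷ Γ) ⊆ (σ ∷ Δ)
ext r (here p)  = here p
ext r (there x) = there (r x)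

ren : Γ ⊆ Δ → Term Γ σ → Term Δ σ
ren r (var x) = var (r x)
ren r (lam t) = lam (ren (ext r) t)
ren r (t · u) = ren r t · ren r u
ren r true    = true
ren r false   = false
ren r cond    = cond
ren r zero    = zero
ren r suc     = suc
ren r rec     = rec
ren r pair    = pair
ren r fst     = fst
ren r snd     = snd
ren r nil     = nil
ren r snoc    = snoc
ren r seqrec  = seqrec

wk : Term Γ σ → Term (τ ∷ Γ) σ
wk = ren there

Sub : Ctx → Ctx → Set
Sub Γ Δ = ∀ {σ} → σ ∈ Γ → Term Δ σ

exts : Sub Γ Δ → Sub (σ ∷ Γ) (σ ∷ Δ)
exts s (here p)  = var (here p)
exts s (there x) = wk (s x)

sub : Sub Γ Δ → Term Γ σ → Term Δ σ
sub s (var x) = s x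
sub s (lam t) = lam (sub (exts s) t)
sub s (t · u) = sub s t · sub s u
sub s true    = true
sub s false   = false
sub s cond    = cond
sub s zero    = zero
sub s suc     = suc
sub s rec     = rec
sub s pair    = pair
sub s fst     = fst
sub s snd     = snd
sub s nil     = nil
sub s snoc    = snoc
sub s seqrec  = seqrec

-- Replaces the most recent variable by t and renames the others along r.
inst : Γ ⊆ Δ → Term Δ σ → Sub (σ ∷ Γ) Δ
inst r t (here refl) = t
inst r t (there x)   = var (r x)

infix 10 _[_]

_[_] : Term (σ ∷ Γ) τ → Term Γ σ → Term Γ τ
t [ u ] = sub (inst id u) t

v0 : Term (σ ∷ Γ) σ
v0 = var (here refl)

v1 : Term (τ ∷ σ ∷ Γ) σ
v1 = wk v0

v2 : Term (ρ ∷ τ ∷ σ ∷ Γ) σ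
v2 = wk v1

v3 : Term (υ ∷ ρ ∷ τ ∷ σ ∷ Γ) σ
v3 = wk v2

v4 : Term (ω ∷ υ ∷ ρ ∷ τ ∷ σ ∷ Γ) σ
v4 = wk v3

infix  8 _≐_
infixr 7 _∧_
infixr 6 _∨_
infixr 5 _⊃_

data Formula (Γ : Ctx) : Set where
  _≐_         : Term Γ σ → Term Γ σ → Formula Γ
  ⊥           : Formula Γ
  _∧_ _∨_ _⊃_ : Formula Γ → Formula Γ → Formula Γ
  all ex      : Formula (σ ∷ Γ) → Formula Γ

renF : Γ ⊆ Δ → Formula Γ → Formula Δ
renF r (t ≐ u) = ren r t ≐ ren r u
renF r ⊥       = ⊥
renF r (φ ∧ ψ) = renF r φ ∧ renF r ψ
renF r (φ ∨ ψ) = renF r φ ∨ renF r ψ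
renF r (φ ⊃ ψ) = renF r φ ⊃ renF r ψ
renF r (all φ) = all (renF (ext r) φ)
renF r (ex φ)  = ex (renF (ext r) φ)

wkF : Formula Γ → Formula (σ ∷ Γ)
wkF = renF there

subF : Sub Γ Δ → Formula Γ → Formula Δ
subF s (t ≐ u) = sub s t ≐ sub s u
subF s ⊥       = ⊥
subF s (φ ∧ ψ) = subF s φ ∧ subF s ψ
subF s (φ ∨ ψ) = subF s φ ∨ subF s ψ
subF s (φ ⊃ ψ) = subF s φ ⊃ subF s ψ
subF s (all φ) = all (subF (exts s) φ)
subF s (ex φ)  = ex (subF (exts s) φ)

infix 10 _[_]F

_[_]F : Formula (σ ∷ Γ) → Term Γ σ → Formula Γ
φ [ t ]F = subF (inst id t) φ

-- A theory is given by its non-logical axioms, which may have free variables.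
Theory : Set₁
Theory = (Γ : Ctx) → Formula Γ → Set

variable
  S     : Theory
  H     : List (Formula Γ)
  φ ψ χ : Formula Γ

infix 3 _∣_⊢_

-- Intuitionistic many-sorted natural deduction from the axioms of S; the
-- variables in Γ are free and held fixed in the hypotheses.
data _∣_⊢_ (S : Theory) : List (Formula Γ) → Formula Γ → Set where
  hyp   : φ ∈ H → S ∣ H ⊢ φ
  axiom : S Γ φ → S ∣ H ⊢ φ
  ⊥E    : S ∣ H ⊢ ⊥ → S ∣ H ⊢ φ
  ∧I    : S ∣ H ⊢ φ → S ∣ H ⊢ ψ → S ∣ H ⊢ φ ∧ ψ
  ∧E₁   : S ∣ H ⊢ φ ∧ ψ → S ∣ H ⊢ φ
  ∧E₂   : S ∣ H ⊢ φ ∧ ψ → S ∣ H ⊢ ψ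
  ∨I₁   : S ∣ H ⊢ φ → S ∣ H ⊢ φ ∨ ψ
  ∨I₂   : S ∣ H ⊢ ψ → S ∣ H ⊢ φ ∨ ψ
  ∨E    : S ∣ H ⊢ φ ∨ ψ → S ∣ φ ∷ H ⊢ χ → S ∣ ψ ∷ H ⊢ χ → S ∣ H ⊢ χ
  ⊃I    : S ∣ φ ∷ H ⊢ ψ → S ∣ H ⊢ φ ⊃ ψ
  ⊃E    : S ∣ H ⊢ φ ⊃ ψ → S ∣ H ⊢ φ → S ∣ H ⊢ ψ
  allI  : {φ : Formula (σ ∷ Γ)} → S ∣ map wkF H ⊢ φ → S ∣ H ⊢ all φ
  allE  : {φ : Formula (σ ∷ Γ)} → S ∣ H ⊢ all φ → (t : Term Γ σ) → S ∣ H ⊢ φ [ t ]F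
  exI   : {φ : Formula (σ ∷ Γ)} (t : Term Γ σ) → S ∣ H ⊢ φ [ t ]F → S ∣ H ⊢ ex φ
  exE   : {φ : Formula (σ ∷ Γ)} → S ∣ H ⊢ ex φ → S ∣ φ ∷ map wkF H ⊢ wkF ψ → S ∣ H ⊢ ψ

-- E-HA^ω with equality primitive at every type.  Replacement in arbitrary
-- formulas follows from the congruence axioms, β and extensionality.
data HAω (Γ : Ctx) : Formula Γ → Set where
  ≐-refl  : (t : Term Γ σ) → HAω Γ (t ≐ t)
  ≐-sym   : (t u : Term Γ σ) → HAω Γ (t ≐ u ⊃ u ≐ t)
  ≐-trans : (t u v : Term Γ σ) → HAω Γ (t ≐ u ⊃ u ≐ v ⊃ t ≐ v)
  ≐-cong  : (f g : Term Γ (σ ⇒ τ)) (t u : Term Γ σ) →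
            HAω Γ (f ≐ g ⊃ t ≐ u ⊃ f · t ≐ g · u)

  extensionality : (f g : Term Γ (σ ⇒ τ)) →
                   HAω Γ (all (wk f · v0 ≐ wk g · v0) ⊃ f ≐ g)

  β           : (t : Term (σ ∷ Γ) τ) (u : Term Γ σ) → HAω Γ (lam t · u ≐ t [ u ])
  cond-true   : (t u : Term Γ σ) → HAω Γ (cond · true · t · u ≐ t)
  cond-false  : (t u : Term Γ σ) → HAω Γ (cond · false · t · u ≐ u)
  rec-zero    : (a : Term Γ σ) (f : Term Γ (nat ⇒ σ ⇒ σ)) → HAω Γ (rec · a · f · zero ≐ a)
  rec-suc     : (a : Term Γ σ) (f : Term Γ (nat ⇒ σ ⇒ σ)) (n : Term Γ nat) →
                HAω Γ (rec · a · f · (suc · n) ≐ f · n · (rec · a · f · n))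
  fst-pair    : (t : Term Γ σ) (u : Term Γ τ) → HAω Γ (fst · (pair · t · u) ≐ t)
  snd-pair    : (t : Term Γ σ) (u : Term Γ τ) → HAω Γ (snd · (pair · t · u) ≐ u)
  pair-η      : (p : Term Γ (σ ⊗ τ)) → HAω Γ (pair · (fst · p) · (snd · p) ≐ p)
  seqrec-nil  : (a : Term Γ σ) (f : Term Γ (seq τ ⇒ τ ⇒ σ ⇒ σ)) →
                HAω Γ (seqrec · a · f · nil ≐ a)
  seqrec-snoc : (a : Term Γ σ) (f : Term Γ (seq τ ⇒ τ ⇒ σ ⇒ σ))
                (s : Term Γ (seq τ)) (x : Term Γ τ) →
                HAω Γ (seqrec · a · f · (snoc · s · x) ≐ f · s · x · (seqrec · a · f · s))

  suc≢zero : (n : Term Γ nat) → HAω Γ (suc · n ≐ zero ⊃ ⊥)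
  suc-inj  : (m n : Term Γ nat) → HAω Γ (suc · m ≐ suc · n ⊃ m ≐ n)

  bool-cases : (φ : Formula (bool ∷ Γ)) →
               HAω Γ (φ [ true ]F ⊃ φ [ false ]F ⊃ all φ)
  nat-ind    : (φ : Formula (nat ∷ Γ)) →
               HAω Γ (φ [ zero ]F ⊃ all (φ ⊃ subF (inst there (suc · v0)) φ) ⊃ all φ)
  seq-ind    : (φ : Formula (seq τ ∷ Γ)) →
               HAω Γ (φ [ nil ]F
                      ⊃ all (all (wkF φ ⊃ subF (inst (there ∘ there) (snoc · v1 · v0)) φ))
                      ⊃ all φ)

-- A functional specified, for each choice of type parameters, by a defining
-- equation: a formula whose only free variable stands for the functional and
-- in which the arguments are universally quantified.
record Functional : Set₁ where
  field
    Params   : Set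
    type     : Params → Ty
    equation : (p : Params) → Formula (type p ∷ [])

open Functional

infix 2 _≥T[_]_

_≥T[_]_ : Functional → Theory → Functional → Set
F ≥T[ S ] G =
  (p : Params G) →
  Σ (Params F) λ p′ →
  Σ (Term [] (type F p′ ⇒ type G p)) λ s →
  S ∣ equation F p′ ∷ [] ⊢ subF (inst (λ ()) (ren (λ ()) s · v0)) (equation G p)

-- Infinite sequences Π_i X_i are taken with all X_i equal to one type X.
stream : Ty → Ty
stream X = nat ⇒ X

-- x * α, prefixing one entry to an infinite sequence
cons : Term Γ (σ ⇒ stream σ ⇒ stream σ)
cons = lam (lam (lam (rec · v2 · lam (lam (v3 · v1)) · v0)))

-- q_x = λ α. q (x * α)
shift : Term Γ (stream σ ⇒ τ) → Term Γ σ → Term Γ (stream σ ⇒ τ)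
shift q x = lam (wk q · (cons · wk x · v0))

-- The parameters are (X , R).  Under the quantifiers, the variables are
-- q = v0, ε = v1, n (or s) = v2 and the functional itself v3; inside a further
-- λ x they are shifted by one.
mbr : Functional
mbr = record
  { Params   = Ty × Ty
  ; type     = λ (X , R) →
      nat ⇒ (nat ⇒ (X ⇒ R) ⇒ stream X) ⇒ (stream X ⇒ R) ⇒ stream X
  ; equation = λ (X , R) → all (all (all
      (v3 · v2 · v1 · v0
        ≐ v1 · v2 · lam (shift v1 v0 · (v4 · (suc · v3) · v2 · shift v1 v0)))))
  }

MBR : Functional
MBR = record
  { Params   = Ty × Ty
  ; type     = λ (X , R) →
      seq X ⇒ (seq X ⇒ (X ⇒ R) ⇒ stream X) ⇒ (stream X ⇒ R) ⇒ stream X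
  ; equation = λ (X , R) → all (all (all
      (v3 · v2 · v1 · v0
        ≐ v1 · v2 · lam (shift v1 v0 · (v4 · (snoc · v3 · v0) · v2 · shift v1 v0)))))
  }

{-# OPTIONS --safe #-}

-- A dependent family ε is simulated by a simple one whose entries are
-- instructions waiting for the sequence s played so far: either play a fixed x
-- and continue from s * x, or output the rest of the play, ε_s(p), at once.
-- Executing the instructions from s turns mbr_|s| on instructions into MBR_s.
module Submission where

open import Defs
open import Data.List using (List; _∷_; map)
open import Data.List.Membership.Propositional using (_∈_)
open import Data.List.Relation.Binary.Subset.Propositional using (_⊆_)
open import Data.List.Relation.Unary.Any using (here; there)
open import Data.Nat using (ℕ; zero; suc)
open import Data.Product using (Σ; _,_; proj₁; proj₂)
open import Level using (0ℓ)
open import Relation.Binary.Bundles using (Setoid)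
open import Relation.Binary.PropositionalEquality
  using (_≡_; refl; cong; cong₂; subst)
import Relation.Binary.Reasoning.Setoid as SetoidReasoning

open Functional using (type)

private variable
  X R : Ty
  t u : Term Γ σ

sub-ren-id : {s : Sub Δ Γ} {r : Γ ⊆ Δ} →
             (∀ {σ} (x : σ ∈ Γ) → s (r x) ≡ var x) →
             (t : Term Γ τ) → sub s (ren r t) ≡ t
sub-ren-id eq (var x) = eq x
sub-ren-id {s = s} {r} eq (lam t) = cong lam (sub-ren-id eq′ t)
  where
  eq′ : ∀ {σ} (x : σ ∈ _) → exts s (ext r x) ≡ var x
  eq′ (here p)  = refl
  eq′ (there x) = cong wk (eq x)
sub-ren-id eq (t · u) = cong₂ _·_ (sub-ren-id eq t) (sub-ren-id eq u)
sub-ren-id eq true    = refl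
sub-ren-id eq false   = refl
sub-ren-id eq cond    = refl
sub-ren-id eq zero    = refl
sub-ren-id eq suc     = refl
sub-ren-id eq rec     = refl
sub-ren-id eq pair    = refl
sub-ren-id eq fst     = refl
sub-ren-id eq snd     = refl
sub-ren-id eq nil     = refl
sub-ren-id eq snoc    = refl
sub-ren-id eq seqrec  = refl

termSetoid : List (Formula Γ) → Ty → Setoid 0ℓ 0ℓ
termSetoid {Γ} H σ = record
  { Carrier       = Term Γ σ
  ; _≈_           = λ t u → HAω ∣ H ⊢ t ≐ u
  ; isEquivalence = record
    { refl  = axiom (≐-refl _)
    ; sym   = ⊃E (axiom (≐-sym _ _))
    ; trans = λ p q → ⊃E (⊃E (axiom (≐-trans _ _ _)) p) q
    }
  }

open module ≐-Reasoning {Γ σ} {H : List (Formula Γ)} =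
  SetoidReasoning (termSetoid H σ)

module _ {Γ : Ctx} {H : List (Formula Γ)} where

  ≐-rfl : HAω ∣ H ⊢ t ≐ t
  ≐-rfl = axiom (≐-refl _)

  ·-cong : {f g : Term Γ (σ ⇒ τ)} {t u : Term Γ σ} →
           HAω ∣ H ⊢ f ≐ g → HAω ∣ H ⊢ t ≐ u → HAω ∣ H ⊢ f · t ≐ g · u
  ·-cong p q = ⊃E (⊃E (axiom (≐-cong _ _ _ _)) p) q

  funext : {f g : Term Γ (σ ⇒ τ)} →
           HAω ∣ map wkF H ⊢ wk f · v0 ≐ wk g · v0 → HAω ∣ H ⊢ f ≐ g
  funext p = ⊃E (axiom (extensionality _ _)) (allI p)

β-wk : {H : List (Formula (σ ∷ Γ))} (t : Term (σ ∷ Γ) τ) →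
       HAω ∣ H ⊢ wk (lam t) · v0 ≐ t
β-wk {σ} {Γ} {H = H} t =
  subst (λ u → HAω ∣ H ⊢ wk (lam t) · v0 ≐ u) (sub-ren-id eq t) (axiom (β _ _))
  where
  eq : ∀ {ρ} (x : ρ ∈ σ ∷ Γ) → inst (λ z → z) v0 (ext there x) ≡ var x
  eq (here refl) = refl
  eq (there x)   = refl

-- The axioms give congruence only for application; under a λ it comes from extensionality.
lam-cong : {H : List (Formula Γ)} {t u : Term (σ ∷ Γ) τ} →
           HAω ∣ map wkF H ⊢ t ≐ u → HAω ∣ H ⊢ lam t ≐ lam u
lam-cong {t = t} {u} p = funext (begin
  wk (lam t) · v0  ≈⟨ β-wk t ⟩
  t                ≈⟨ p ⟩
  u                ≈⟨ β-wk u ⟨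
  wk (lam u) · v0  ∎)

-- `H` is quantified inside the pair so that `develop` can pass under a λ, where the hypotheses
-- become `map wkF H`.
Reduct : Term Γ σ → Set
Reduct {Γ} {σ} t = Σ (Term Γ σ) λ u → ∀ {H} → HAω ∣ H ⊢ t ≐ u

contract : (t : Term Γ (σ ⇒ τ)) (u : Term Γ σ) → Reduct (t · u)
contract (lam t) u                = t [ u ] , axiom (β t u)
contract (rec · a · f) zero       = a , axiom (rec-zero a f)
contract (rec · a · f) (suc · n)  =
  f · n · (rec · a · f · n) , axiom (rec-suc a f n)
contract (seqrec · a · f) (snoc · s · x) =
  f · s · x · (seqrec · a · f · s) , axiom (seqrec-snoc a f s x)
contract t u                      = t · u , ≐-rfl

develop : (t : Term Γ σ) → Reduct t
develop (lam t) = lam (proj₁ (develop t)) , lam-cong (proj₂ (develop t))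
develop (t · u) = proj₁ c , Setoid.trans (termSetoid _ _)
                              (·-cong (proj₂ (develop t)) (proj₂ (develop u)))
                              (proj₂ c)
  where c = contract (proj₁ (develop t)) (proj₁ (develop u))
develop t       = t , ≐-rfl

reduce : ℕ → (t : Term Γ σ) → Reduct t
reduce zero    t = t , ≐-rfl
reduce (suc n) t = proj₁ r , Setoid.trans (termSetoid _ _) (proj₂ (develop t)) (proj₂ r)
  where r = reduce n (proj₁ (develop t))

-- Eight rounds of parallel reduction normalise all the terms met below.
conv : {H : List (Formula Γ)} {t u : Term Γ σ} →
       proj₁ (reduce 8 t) ≡ proj₁ (reduce 8 u) → HAω ∣ H ⊢ t ≐ u
conv {H = H} {t} {u} eq = begin
  t                   ≈⟨ proj₂ (reduce 8 t) ⟩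
  proj₁ (reduce 8 t)  ≡⟨ eq ⟩
  proj₁ (reduce 8 u)  ≈⟨ proj₂ (reduce 8 u) ⟨
  u                   ∎

-- An instruction gets the sequence s played so far, the position i still to be
-- read off and what to do with position i once an entry is chosen.
Instr : Ty → Ty
Instr X = seq X ⇒ nat ⇒ (X ⇒ X) ⇒ X

play : Term Γ (X ⇒ Instr X)
play = lam (lam (lam (lam (v0 · v3))))

-- resume · i · s · α · x is position i of the run of α from s whose first entry is x.
resume : Term Γ (nat ⇒ seq X ⇒ stream (Instr X) ⇒ X ⇒ X)
resume = rec
  · lam (lam (lam v0))
  · lam (lam (lam (lam (lam
      -- `α` still begins with the instruction that chose `x`, so the next one is at index 1; the
      -- tail of `α` is passed on for the same reason.
      (v1 · (suc · zero) · (snoc · v2 · v0) · v4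
        · (v3 · (snoc · v2 · v0) · lam (v2 · (suc · v0))))))))

-- Later instructions are reached only through the continuation, so a first instruction that answers
-- by itself fixes the whole run.
run : Term Γ (seq X ⇒ stream (Instr X) ⇒ stream X)
run = lam (lam (lam (v1 · zero · v2 · v0 · (resume · v0 · v2 · v1))))

-- The dependence on `s` moves from the index of the family into the instruction, which learns `s`
-- only when executed. Moves offered to `p` are encoded by `play`.
simplify : Term Γ ((seq X ⇒ (X ⇒ R) ⇒ stream X) ⇒ nat ⇒ (Instr X ⇒ R) ⇒ stream (Instr X))
simplify = lam (lam (lam (lam (lam (lam (lam
  (wk (wk v4) · v2 · lam (wk v4 · (play · v0)) · v1)))))))

length : Term Γ (seq X ⇒ nat)
length = seqrec · zero · lam (lam (lam (suc · v0)))

MBR-from-mbr : Term Γ (type mbr (Instr X , R) ⇒ type MBR (X , R))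
MBR-from-mbr = lam (lam (lam (lam
  (run · v2 · (v3 · (length · v2) · (simplify · v1) · lam (v1 · (run · v3 · v0)))))))

-- Variables: i = v0, α = v1, x = v2 and s = v3.
run-play-at : {H : List (Formula (stream (Instr X) ∷ X ∷ seq X ∷ Γ))} →
  HAω ∣ H ⊢ all (run · v3 · (cons · (play · v2) · v1) · v0
                   ≐ cons · v2 · (run · (snoc · v3 · v2) · v1) · v0)
run-play-at = ⊃E (⊃E (axiom (nat-ind _)) (conv refl)) (allI (⊃I (begin
  run · v3 · (cons · (play · v2) · v1) · (suc · v0)
    ≈⟨ conv refl ⟩
  v1 · zero · (snoc · v3 · v2) · v0 · (resume · v0 · (snoc · v3 · v2) · lam (v2 · v0))
    -- An η-step, which `reduce` does not perform: the tail of `cons · (play · x) · α` is only an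
    -- expansion of `α`.
    ≈⟨ ·-cong ≐-rfl (·-cong ≐-rfl (funext (conv refl))) ⟩
  v1 · zero · (snoc · v3 · v2) · v0 · (resume · v0 · (snoc · v3 · v2) · v1)
    ≈⟨ conv refl ⟩
  cons · v2 · (run · (snoc · v3 · v2) · v1) · (suc · v0) ∎)))

-- Executing one `play` is what moves the simulation from `s` to `s * x`, and `q` to `q_x`.
run-play : {H : List (Formula Γ)} →
  HAω ∣ H ⊢ all {σ = seq X} (all (all (run · v2 · (cons · (play · v1) · v0)
                                        ≐ cons · v1 · (run · (snoc · v2 · v1) · v0))))
run-play = allI (allI (allI (⊃E (axiom (extensionality _ _)) run-play-at)))

theorem4p9 : mbr ≥T[ HAω ] MBR
theorem4p9 (X , R) = (Instr X , R) , MBR-from-mbr , allI (allI (allI (begin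
  MBR-from-mbr · v3 · v2 · v1 · v0
    ≈⟨ conv refl ⟩
  run · v2 · (v3 · (length · v2) · (simplify · v1) · outcome)
    ≈⟨ ·-cong ≐-rfl (allE (allE (allE (hyp (here refl)) (length · v2)) (simplify · v1)) outcome) ⟩
  run · v2 · (simplify · v1 · (length · v2)
    · lam (shift (wk outcome) v0 · (v4 · (suc · (length · v3)) · (simplify · v2) · shift (wk outcome) v0)))
    -- At each position `run` executes the first instruction, which reads that position off `ε_s`.
    ≈⟨ funext (conv refl) ⟩
  v1 · v2 · lam (shift (wk outcome) (play · v0)
    · (v4 · (suc · (length · v3)) · (simplify · v2) · shift (wk outcome) (play · v0)))
    ≈⟨ ·-cong ≐-rfl (lam-cong (·-cong shift-outcome (·-cong ≐-rfl shift-outcome))) ⟩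
  v1 · v2 · lam (outcome′ · (v4 · (suc · (length · v3)) · (simplify · v2) · outcome′))
    -- `length` of `s * x` computes to the successor of `length · s`, and `outcome′` is the outcome
    -- function of the simulation at `s * x` and `q_x`; hence the recursive call of `mbr` is the one
    -- inside `MBR-from-mbr`.
    ≈⟨ conv refl ⟩
  v1 · v2 · lam (shift v1 v0 · (MBR-from-mbr · v4 · (snoc · v3 · v0) · v2 · shift v1 v0)) ∎)))
  where
  outcome : Term ((stream X ⇒ R) ∷ σ ∷ seq X ∷ Γ) (stream (Instr X) ⇒ R)
  outcome = lam (v1 · (run · v3 · v0))

  outcome′ : Term (X ∷ (stream X ⇒ R) ∷ σ ∷ seq X ∷ Γ) (stream (Instr X) ⇒ R)
  outcome′ = lam (shift v2 v1 · (run · (snoc · v4 · v1) · v0))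

  shift-outcome : {H : List (Formula (X ∷ (stream X ⇒ R) ∷ σ ∷ seq X ∷ Γ))} →
                  HAω ∣ H ⊢ shift (wk outcome) (play · v0) ≐ outcome′
  shift-outcome = lam-cong (begin
    wk (wk outcome) · (cons · (play · v1) · v0)
      ≈⟨ conv refl ⟩
    v2 · (run · v4 · (cons · (play · v1) · v0))
      ≈⟨ ·-cong ≐-rfl (allE (allE (allE (run-play {X = X}) v4) v1) v0) ⟩
    v2 · (cons · v1 · (run · (snoc · v4 · v1) · v0))
      ≈⟨ conv refl ⟩
    shift v2 v1 · (run · (snoc · v4 · v1) · v0) ∎)
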